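{- Let $n\ge 2$ be an integer such that $n+1$ is an odd prime. If $[\delta_0,\dots,\delta_n]\in\{ -1,1\}^{n+1}$ satisfies $\sum_{j=0}^n\delta_j\binom{n}{j}=0$, then either $\delta_j=(-1)^j$ for all $j$ or $\delta_j=-(-1)^j$ for all $j$. Equivalently, $\hat J_n=0$.
   Context: For even $n$, $\hat J_n$ is the number of vectors $(\epsilon_0,\dots,\epsilon_{n/2-1})\in\{ -1,0,1\}^{n/2}$ with $\sum_{i=0}^{n/2-1}\epsilon_i\binom{n}{i}=(-1)^{n/2+1}\frac12\binom{n}{n/2}$, excluding the alternating vector $\epsilon_i=(-1)^i$. -}

module Defs where

open import Data.Fin.Base using (toℕ)
open import Data.Fin.Properties using (all?)
open import Data.Integer.Base using (ℤ; +_; 0ℤ; 1ℤ; -1ℤ; _*_; _^_)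
open import Data.Integer.Properties using (+-0-commutativeMonoid; _≟_)
open import Data.List.Base using (List; []; _∷_; cartesianProductWith; filter; length)
open import Data.Nat.Base as ℕ using (ℕ; zero; suc)
open import Data.Nat.Combinatorics using (_C_)
open import Data.Nat.DivMod using (_/_)
open import Data.Product.Base using (_×_)
open import Data.Rational.Unnormalised as ℚᵘ using (_≃_)
open import Data.Rational.Unnormalised.Properties using (_≃?_)
open import Data.Vec.Base using (Vec; []; _∷_; lookup)
open import Relation.Binary.PropositionalEquality using (_≡_)
open import Relation.Nullary using (¬_; Dec; ¬?; _×-dec_)

open import Algebra.Properties.CommutativeMonoid.Sum +-0-commutativeMonoid public
  using (sum-syntax; sum⁺-syntax)

-- All vectors of length m with entries in xs; each occurs exactly once when
-- xs has no repetitions.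
vectors : ∀ {A : Set} → List A → (m : ℕ) → List (Vec A m)
vectors xs zero    = [] ∷ []
vectors xs (suc m) = cartesianProductWith _∷_ xs (vectors xs m)

-- Both sides are compared as rationals, because of the factor ½ on the right.
HalfSum : (n : ℕ) → Vec ℤ (n / 2) → Set
HalfSum n ε =
  (∑[ i < n / 2 ] (lookup ε i * + (n C toℕ i))) ℚᵘ./ 1
    ≃ (-1ℤ ^ (n / 2 ℕ.+ 1) * + (n C (n / 2))) ℚᵘ./ 2

Alternating : ∀ {m} → Vec ℤ m → Set
Alternating ε = ∀ i → lookup ε i ≡ -1ℤ ^ toℕ i

Counted : (n : ℕ) → Vec ℤ (n / 2) → Set
Counted n ε = HalfSum n ε × ¬ Alternating ε

counted? : ∀ n (ε : Vec ℤ (n / 2)) → Dec (Counted n ε)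
counted? n ε = (_ ≃? _) ×-dec ¬? (all? λ i → lookup ε i ≟ -1ℤ ^ toℕ i)

-- Only meaningful for even n; for odd n the value is junk.
Ĵ : ℕ → ℕ
Ĵ n = length (filter (counted? n) (vectors (-1ℤ ∷ 0ℤ ∷ 1ℤ ∷ []) (n / 2)))

{-# OPTIONS --safe #-}

-- For p = n + 1 prime, C(n,j) ≡ (-1)^j mod p, so a vanishing sum of δ_j C(n,j) makes
-- p divide the sum of the p signs δ_j (-1)^j.  Writing each sign as 1 - 2a_j with
-- a_j ∈ {0,1} gives p ∣ 2 Σ a_j with 0 ≤ Σ a_j ≤ p; p being odd, Σ a_j is 0 or p.
-- For Ĵ with m = n/2, put ε_i (-1)^i = 1 - a_i with a_i ∈ {0,1,2}: the equation again
-- becomes p ∣ 2 Σ a_i, now with Σ a_i ≤ 2m < p, so every a_i is 0.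
module Submission where

open import Defs
import Data.Integer.Properties as ℤ
open import Algebra.Properties.AbelianGroup ℤ.+-0-abelianGroup using (∙-cancelʳ)
import Algebra.Properties.CommutativeMonoid.Sum as ∑-Properties
open import Data.Fin.Base using (Fin; toℕ; zero; suc)
open import Data.Fin.Properties using (toℕ<n)
open import Data.Integer.Base using (ℤ; +_; 0ℤ; 1ℤ; -1ℤ; -_; _*_; _^_; _+_; _-_)
open import Data.Integer.Divisibility.Signed
  using (divides; ∣ᵤ⇒∣; ∣⇒∣ᵤ; ∣m∣n⇒∣m+n; ∣m∣n⇒∣m-n; ∣n⇒∣m*n; ∣-refl)
  renaming (_∣_ to _∣ℤ_)
open import Data.Integer.Tactic.RingSolver using (solve-∀)
open import Data.List.Base using (List; []; _∷_; length)
open import Data.List.Membership.Propositional using (_∈_)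
open import Data.List.Properties using (filter-none)
open import Data.List.Relation.Unary.All as All using (All; []; _∷_)
open import Data.List.Relation.Unary.All.Properties using (cartesianProductWith⁺)
open import Data.List.Relation.Unary.Any using (here; there)
open import Data.Nat.Base as ℕ using (ℕ; zero; suc; _≤_; _<_; z≤n; s≤s)
open import Data.Nat.Combinatorics using (_C_; nC1≡n; nCk+nC[k+1]≡[n+1]C[k+1])
open import Data.Nat.Divisibility using (_∣_; _∤_; >⇒∤; ∣⇒≤; m∣m*n; m%n≡0⇒n∣m)
open import Data.Nat.DivMod using (_/_; _%_; m≡m%n+[m/n]*n; m/n≤m; m%n<n; [m+kn]%n≡m%n)
open import Data.Nat.Primality using (Prime; euclidsLemma)
import Data.Nat.Properties as ℕ
import Data.Nat.Tactic.RingSolver as ℕ-Solver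
open import Data.Product.Base using (_×_; _,_; ∃; proj₁; proj₂)
open import Data.Rational.Unnormalised.Base using (*≡*)
open import Data.Sum.Base using (_⊎_; inj₁; inj₂)
open import Data.Vec.Base using (Vec; _∷_; lookup)
open import Function.Base using (_∘_)
open import Relation.Binary.PropositionalEquality
  using (_≡_; refl; sym; trans; cong; cong₂; subst; setoid; module ≡-Reasoning)
open import Relation.Nullary using (contradiction)

open ∑-Properties ℕ.+-0-commutativeMonoid using () renaming (sum to sumℕ)
open ∑-Properties ℤ.+-0-commutativeMonoid using () renaming (sum to sumℤ)

-- Binomial coefficients modulo a prime.

-- The absorption identity, by induction through Pascal's rule; the division-free form lets Euclid's
-- lemma act on the left-hand product.
[1+k]*[1+n]C[1+k]≡[1+n]*nCk : ∀ n k → suc k ℕ.* (suc n C suc k) ≡ suc n ℕ.* (n C k)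
[1+k]*[1+n]C[1+k]≡[1+n]*nCk zero    zero    = refl
[1+k]*[1+n]C[1+k]≡[1+n]*nCk zero    (suc k) = ℕ.*-zeroʳ (suc (suc k))
[1+k]*[1+n]C[1+k]≡[1+n]*nCk (suc n) zero    =
  trans (ℕ.*-identityˡ _) (trans (nC1≡n (suc (suc n))) (sym (ℕ.*-identityʳ _)))
[1+k]*[1+n]C[1+k]≡[1+n]*nCk (suc n) (suc k) = begin
  suc (suc k) ℕ.* (suc (suc n) C suc (suc k))
    ≡⟨ cong (suc (suc k) ℕ.*_) (nCk+nC[k+1]≡[n+1]C[k+1] (suc n) (suc k)) ⟨
  suc (suc k) ℕ.* (x ℕ.+ y)
    ≡⟨ distribute k x y ⟩
  x ℕ.+ (suc k ℕ.* x ℕ.+ suc (suc k) ℕ.* y)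
    ≡⟨ cong (x ℕ.+_) (cong₂ ℕ._+_ ([1+k]*[1+n]C[1+k]≡[1+n]*nCk n k)
                                  ([1+k]*[1+n]C[1+k]≡[1+n]*nCk n (suc k))) ⟩
  x ℕ.+ (suc n ℕ.* (n C k) ℕ.+ suc n ℕ.* (n C suc k))
    ≡⟨ cong (x ℕ.+_) (ℕ.*-distribˡ-+ (suc n) (n C k) (n C suc k)) ⟨
  x ℕ.+ suc n ℕ.* (n C k ℕ.+ n C suc k)
    ≡⟨ cong (λ z → x ℕ.+ suc n ℕ.* z) (nCk+nC[k+1]≡[n+1]C[k+1] n k) ⟩
  suc (suc n) ℕ.* x ∎
  where
  open ≡-Reasoning
  x = suc n C suc k
  y = suc n C suc (suc k)
  distribute : ∀ k x y → suc (suc k) ℕ.* (x ℕ.+ y) ≡ x ℕ.+ (suc k ℕ.* x ℕ.+ suc (suc k) ℕ.* y)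
  distribute = ℕ-Solver.solve-∀

-- By absorption the prime divides `suc k` times the coefficient, and `0 < suc k < suc n` rules out
-- the first factor.
p∣pC[1+k] : ∀ {n k} → Prime (suc n) → k < n → suc n ∣ suc n C suc k
p∣pC[1+k] {n} {k} pr k<n
  with euclidsLemma (suc k) (suc n C suc k) pr
         (subst (suc n ∣_) (sym ([1+k]*[1+n]C[1+k]≡[1+n]*nCk n k)) (m∣m*n (n C k)))
... | inj₁ p∣1+k = contradiction p∣1+k (>⇒∤ (s≤s k<n))
... | inj₂ p∣C   = p∣C

-- Neighbours in row `n` add up to an inner entry of row `suc n`, which vanishes modulo the prime;
-- so the residues alternate in sign, starting from 1.
[p-1]Ck≡[-1]^k : ∀ {n} k → Prime (suc n) → k ≤ n → + suc n ∣ℤ + (n C k) - -1ℤ ^ k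
[p-1]Ck≡[-1]^k         zero    pr _   = divides 0ℤ refl
[p-1]Ck≡[-1]^k {n} (suc k) pr k<n = subst (+ suc n ∣ℤ_) eq
  (∣m∣n⇒∣m-n (∣ᵤ⇒∣ {i = + (suc n C suc k)} (p∣pC[1+k] pr k<n)) ([p-1]Ck≡[-1]^k k pr (ℕ.<⇒≤ k<n)))
  where
  rearrange : ∀ x y s → (x + y) - (x - s) ≡ y - -1ℤ * s
  rearrange = solve-∀
  eq : + (suc n C suc k) - (+ (n C k) - -1ℤ ^ k) ≡ + (n C suc k) - -1ℤ ^ suc k
  eq = trans
    (cong (λ z → + z - (+ (n C k) - -1ℤ ^ k)) (sym (nCk+nC[k+1]≡[n+1]C[k+1] n k)))
    (rearrange (+ (n C k)) (+ (n C suc k)) (-1ℤ ^ k))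

-- Congruences and bounds for finite sums.

∣-sum-difference : ∀ {d k} {f g : Fin k → ℤ} → (∀ i → d ∣ℤ f i - g i) → d ∣ℤ sumℤ f - sumℤ g
∣-sum-difference {k = zero}          d∣ = divides 0ℤ refl
∣-sum-difference {d} {suc k} {f} {g} d∣ = subst (d ∣ℤ_) (rearrange (f zero) (g zero) _ _)
  (∣m∣n⇒∣m+n (d∣ zero) (∣-sum-difference {f = f ∘ suc} {g ∘ suc} (d∣ ∘ suc)))
  where
  rearrange : ∀ a b x y → (a - b) + (x - y) ≡ (a + x) - (b + y)
  rearrange = solve-∀

-- The length `k` is left free to cover both the full row (`suc n`) and the half row (`n / 2`).
binomial-sum≡alternating-sum : ∀ {n k} → Prime (suc n) → k ≤ suc n → (f : Fin k → ℤ) →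
  + suc n ∣ℤ (∑[ i < k ] (f i * + (n C toℕ i))) - (∑[ i < k ] (f i * -1ℤ ^ toℕ i))
binomial-sum≡alternating-sum {n} pr k≤p f = ∣-sum-difference λ i →
  subst (+ suc n ∣ℤ_) (distrib (f i) _ _)
    (∣n⇒∣m*n (f i)
      ([p-1]Ck≡[-1]^k (toℕ i) pr (ℕ.≤-pred (ℕ.<-≤-trans (toℕ<n i) k≤p))))
  where
  distrib : ∀ a x y → a * (x - y) ≡ a * x - a * y
  distrib = solve-∀

-- The factor `c` is 2 for sign vectors, whose entries differ from 1 by 0 or 2, and 1 for entries in
-- -1, 0, 1.
sum-deficit : ∀ {k} c (f : Fin k → ℤ) (a : Fin k → ℕ) →
  (∀ i → f i + c * + a i ≡ 1ℤ) → sumℤ f + c * + sumℕ a ≡ + k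
sum-deficit {zero}  c f a eq = trans (ℤ.+-identityˡ _) (ℤ.*-zeroʳ c)
sum-deficit {suc k} c f a eq =
  trans (rearrange (f zero) _ c (+ a zero) _)
        (cong₂ _+_ (eq zero) (sum-deficit c (f ∘ suc) (a ∘ suc) (eq ∘ suc)))
  where
  rearrange : ∀ x y c u v → (x + y) + c * (u + v) ≡ (x + c * u) + (y + c * v)
  rearrange = solve-∀

sum≤k*b : ∀ {k b} (a : Fin k → ℕ) → (∀ i → a i ≤ b) → sumℕ a ≤ k ℕ.* b
sum≤k*b {zero}  a a≤b = z≤n
sum≤k*b {suc k} a a≤b = ℕ.+-mono-≤ (a≤b zero) (sum≤k*b (a ∘ suc) (a≤b ∘ suc))

sum≡0⇒≡0 : ∀ {k} (a : Fin k → ℕ) → sumℕ a ≡ 0 → ∀ i → a i ≡ 0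
sum≡0⇒≡0 a eq zero    = ℕ.m+n≡0⇒m≡0 (a zero) eq
sum≡0⇒≡0 a eq (suc i) = sum≡0⇒≡0 (a ∘ suc) (ℕ.m+n≡0⇒n≡0 (a zero) eq) i

-- A total that reaches its maximum leaves no entry room to fall short: bounding all the others by
-- `b` forces the remaining one up to `b`.
k*b≤sum⇒≡b : ∀ {k b} (a : Fin k → ℕ) → (∀ i → a i ≤ b) → k ℕ.* b ≤ sumℕ a → ∀ i → a i ≡ b
k*b≤sum⇒≡b {suc k} {b} a a≤b le zero = ℕ.≤-antisym (a≤b zero)
  (ℕ.+-cancelʳ-≤ (k ℕ.* b) b (a zero)
    (ℕ.≤-trans le (ℕ.+-monoʳ-≤ (a zero) (sum≤k*b (a ∘ suc) (a≤b ∘ suc)))))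
k*b≤sum⇒≡b {suc k} {b} a a≤b le (suc i) = k*b≤sum⇒≡b (a ∘ suc) (a≤b ∘ suc)
  (ℕ.+-cancelˡ-≤ b (k ℕ.* b) (sumℕ (a ∘ suc))
    (ℕ.≤-trans le (ℕ.+-monoˡ-≤ (sumℕ (a ∘ suc)) (a≤b zero)))) i

-- Powers of -1 and deficits from the alternating pattern.

[-1]^k≡±1 : ∀ k → -1ℤ ^ k ≡ 1ℤ ⊎ -1ℤ ^ k ≡ -1ℤ
[-1]^k≡±1 zero    = inj₁ refl
[-1]^k≡±1 (suc k) with [-1]^k≡±1 k
... | inj₁ eq = inj₂ (cong (-1ℤ *_) eq)
... | inj₂ eq = inj₁ (cong (-1ℤ *_) eq)

[-1]^k*[-1]^k≡1 : ∀ k → -1ℤ ^ k * -1ℤ ^ k ≡ 1ℤ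
[-1]^k*[-1]^k≡1 k with [-1]^k≡±1 k
... | inj₁ eq = cong₂ _*_ eq eq
... | inj₂ eq = cong₂ _*_ eq eq

*[-1]^k-transpose : ∀ x y k → x * -1ℤ ^ k ≡ y → x ≡ y * -1ℤ ^ k
*[-1]^k-transpose x y k eq = begin
  x                       ≡⟨ ℤ.*-identityʳ x ⟨
  x * 1ℤ                  ≡⟨ cong (x *_) ([-1]^k*[-1]^k≡1 k) ⟨
  x * (-1ℤ ^ k * -1ℤ ^ k) ≡⟨ ℤ.*-assoc x _ _ ⟨
  x * -1ℤ ^ k * -1ℤ ^ k   ≡⟨ cong (_* -1ℤ ^ k) eq ⟩
  y * -1ℤ ^ k             ∎
  where open ≡-Reasoning

-- The product of two signs is again a sign; `a` is 1 exactly where `x` disagrees with the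
-- alternating pattern.
sign-deficit : ∀ {x} k → x ≡ -1ℤ ⊎ x ≡ 1ℤ → ∃ λ a → a ≤ 1 × x * -1ℤ ^ k + + 2 * + a ≡ 1ℤ
sign-deficit k x∈ with [-1]^k≡±1 k
sign-deficit k (inj₁ refl) | inj₁ eq rewrite eq = 1 , s≤s z≤n , refl
sign-deficit k (inj₁ refl) | inj₂ eq rewrite eq = 0 , z≤n , refl
sign-deficit k (inj₂ refl) | inj₁ eq rewrite eq = 0 , z≤n , refl
sign-deficit k (inj₂ refl) | inj₂ eq rewrite eq = 1 , s≤s z≤n , refl

trit-deficit : ∀ {x} k → x ∈ -1ℤ ∷ 0ℤ ∷ 1ℤ ∷ [] → ∃ λ a → a ≤ 2 × x * -1ℤ ^ k + 1ℤ * + a ≡ 1ℤ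
trit-deficit k x∈ with [-1]^k≡±1 k
trit-deficit k (here refl)                 | inj₁ eq rewrite eq = 2 , ℕ.≤-refl , refl
trit-deficit k (here refl)                 | inj₂ eq rewrite eq = 0 , z≤n , refl
trit-deficit k (there (here refl))         | _                  = 1 , s≤s z≤n , refl
trit-deficit k (there (there (here refl))) | inj₁ eq rewrite eq = 0 , z≤n , refl
trit-deficit k (there (there (here refl))) | inj₂ eq rewrite eq = 2 , ℕ.≤-refl , refl

-- Vanishing signed sums over the full row.

n∣m∧m<n⇒m≡0 : ∀ {m n} → n ∣ m → m < n → m ≡ 0
n∣m∧m<n⇒m≡0 {zero}  n∣m m<n = refl
n∣m∧m<n⇒m≡0 {suc m} n∣m m<n = contradiction n∣m (>⇒∤ m<n)

odd-prime∣2*m⇒∣m : ∀ {p m} → Prime p → 2 < p → + p ∣ℤ + 2 * + m → p ∣ m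
odd-prime∣2*m⇒∣m {p} {m} pr 2<p p∣2m
  with euclidsLemma 2 m pr (subst (p ∣_) (ℤ.abs-* (+ 2) (+ m)) (∣⇒∣ᵤ p∣2m))
... | inj₁ p∣2 = contradiction p∣2 (>⇒∤ 2<p)
... | inj₂ p∣m = p∣m

signs-alternate : ∀ n → 2 ≤ n → Prime (suc n) → (δ : Fin (suc n) → ℤ) →
  (∀ j → δ j ≡ -1ℤ ⊎ δ j ≡ 1ℤ) →
  ∑[ j ≤ n ] (δ j * + (n C toℕ j)) ≡ 0ℤ →
  (∀ j → δ j ≡ -1ℤ ^ toℕ j) ⊎ (∀ j → δ j ≡ - (-1ℤ ^ toℕ j))
signs-alternate n 2≤n pr δ δ∈ Σ≡0 = conclude (sumℕ a) refl
  where
  p = suc n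
  deficit = λ j → sign-deficit (toℕ j) (δ∈ j)
  a = λ j → proj₁ (deficit j)
  a≤1 = λ j → proj₁ (proj₂ (deficit j))
  a-eq = λ j → proj₂ (proj₂ (deficit j))
  f = λ j → δ j * -1ℤ ^ toℕ j

  rearrange : ∀ x y → x + y + (0ℤ - x) ≡ y
  rearrange = solve-∀

  p∣A : p ∣ sumℕ a
  -- With `A = sumℕ a`, `sum-deficit` gives `sumℤ f + 2A = p`, while `0 - sumℤ f` is divisible by
  -- `p` since the binomial sum is 0; adding the two leaves `2A`.
  p∣A = odd-prime∣2*m⇒∣m pr (s≤s 2≤n) (subst (+ p ∣ℤ_) (rearrange (sumℤ f) _)
    (∣m∣n⇒∣m+n (subst (+ p ∣ℤ_) (sym (sum-deficit (+ 2) f a a-eq)) ∣-refl)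
      (subst (λ z → + p ∣ℤ z - sumℤ f) Σ≡0 (binomial-sum≡alternating-sum pr ℕ.≤-refl δ))))

  conclude : ∀ A → sumℕ a ≡ A →
    (∀ j → δ j ≡ -1ℤ ^ toℕ j) ⊎ (∀ j → δ j ≡ - (-1ℤ ^ toℕ j))
  conclude zero A≡0 = inj₁ λ j → trans
    (*[-1]^k-transpose (δ j) 1ℤ (toℕ j)
      (trans (sym (ℤ.+-identityʳ _))
        (subst (λ z → f j + + 2 * + z ≡ 1ℤ) (sum≡0⇒≡0 a A≡0 j) (a-eq j))))
    (ℤ.*-identityˡ _)
  -- A positive multiple of `p` is at least `p`, the maximum for `p` deficits bounded by 1, so every
  -- deficit is 1.
  conclude (suc A) A≡ = inj₂ λ j → trans
    (*[-1]^k-transpose (δ j) -1ℤ (toℕ j)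
      (∙-cancelʳ (+ 2) (f j) -1ℤ
        (subst (λ z → f j + + 2 * + z ≡ 1ℤ) (k*b≤sum⇒≡b a a≤1 p*1≤A j) (a-eq j))))
    (ℤ.-1*i≡-i _)
    where
    p*1≤A : p ℕ.* 1 ≤ sumℕ a
    p*1≤A = subst (_≤ sumℕ a) (sym (ℕ.*-identityʳ p))
      (subst (p ≤_) (sym A≡) (∣⇒≤ (subst (p ∣_) A≡ p∣A)))

-- Half sums and the count `Ĵ`.

∈-vectors⇒lookup∈ : ∀ {A : Set} (xs : List A) m → All (λ v → ∀ i → lookup v i ∈ xs) (vectors xs m)
∈-vectors⇒lookup∈ xs zero    = (λ ()) ∷ []
∈-vectors⇒lookup∈ xs (suc m) =
  cartesianProductWith⁺ (setoid _) (setoid _) _∷_ xs (vectors xs m)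
    λ { x∈ v∈ zero    → x∈
      ; x∈ v∈ (suc i) → All.lookup (∈-vectors⇒lookup∈ xs m) v∈ i }

2∤1+n⇒n≡n/2*2 : ∀ n → 2 ∤ suc n → n ≡ n / 2 ℕ.* 2
2∤1+n⇒n≡n/2*2 n 2∤1+n with n % 2 in r | m≡m%n+[m/n]*n n 2 | m%n<n n 2
... | 0 | n≡ | _ = n≡
-- Remainder 1 would give `suc n = 2 + n / 2 * 2`, which is even.
... | 1 | n≡ | _ = contradiction
  (m%n≡0⇒n∣m (suc n) 2 (trans (cong (λ z → suc z % 2) n≡) ([m+kn]%n≡m%n 2 (n / 2) 2))) 2∤1+n
... | suc (suc _) | _ | s≤s (s≤s ())

-- Modulo p = 1 + 2m, with Σ ≡ T and c ≡ s, this turns 2Σ = -sc into 2A ≡ 0.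
double-deficit : ∀ p m Σ T A s c →
  p ≡ 1ℤ + m * + 2 → T + 1ℤ * A ≡ m → Σ * + 2 ≡ -1ℤ * s * c → s * s ≡ 1ℤ →
  p + + 2 * (Σ - T) + s * (c - s) ≡ + 2 * A
double-deficit p m Σ T A s c p≡ T+A≡ 2Σ≡ s²≡1 = begin
  p + + 2 * (Σ - T) + s * (c - s)
    ≡⟨ cong (λ z → z + + 2 * (Σ - T) + s * (c - s)) p≡ ⟩
  1ℤ + m * + 2 + + 2 * (Σ - T) + s * (c - s)
    ≡⟨ expand m Σ T s c ⟩
  1ℤ + m * + 2 + (Σ * + 2 - + 2 * T) + (s * c - s * s)
    ≡⟨ cong₂ (λ u v → 1ℤ + u * + 2 + (v - + 2 * T) + (s * c - s * s)) (sym T+A≡) 2Σ≡ ⟩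
  1ℤ + (T + 1ℤ * A) * + 2 + (-1ℤ * s * c - + 2 * T) + (s * c - s * s)
    ≡⟨ cong (λ z → 1ℤ + (T + 1ℤ * A) * + 2 + (-1ℤ * s * c - + 2 * T) + (s * c - z)) s²≡1 ⟩
  1ℤ + (T + 1ℤ * A) * + 2 + (-1ℤ * s * c - + 2 * T) + (s * c - 1ℤ)
    ≡⟨ collapse A T s c ⟩
  + 2 * A ∎
  where
  open ≡-Reasoning
  expand : ∀ m Σ T s c → 1ℤ + m * + 2 + + 2 * (Σ - T) + s * (c - s)
                       ≡ 1ℤ + m * + 2 + (Σ * + 2 - + 2 * T) + (s * c - s * s)
  expand = solve-∀
  collapse : ∀ A T s c → 1ℤ + (T + 1ℤ * A) * + 2 + (-1ℤ * s * c - + 2 * T) + (s * c - 1ℤ)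
                       ≡ + 2 * A
  collapse = solve-∀

-- Here the deficits total at most `2m = n`, strictly below `p`, so divisibility by `p` leaves only
-- total 0 and hence a single pattern.
halfSum⇒alternating : ∀ n → 2 ≤ n → Prime (suc n) → 2 ∤ suc n → (ε : Vec ℤ (n / 2)) →
  (∀ i → lookup ε i ∈ -1ℤ ∷ 0ℤ ∷ 1ℤ ∷ []) → HalfSum n ε → Alternating ε
halfSum⇒alternating n 2≤n pr 2∤p ε ε∈ (*≡* Σ*2≡) i = trans
  (*[-1]^k-transpose (lookup ε i) 1ℤ (toℕ i)
    (trans (sym (ℤ.+-identityʳ _))
      (subst (λ z → f i + 1ℤ * + z ≡ 1ℤ) (sum≡0⇒≡0 a A≡0 i) (a-eq i))))
  (ℤ.*-identityˡ _)
  where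
  p = suc n
  m = n / 2
  deficit = λ i → trit-deficit (toℕ i) (ε∈ i)
  a = λ i → proj₁ (deficit i)
  a≤2 = λ i → proj₁ (proj₂ (deficit i))
  a-eq = λ i → proj₂ (proj₂ (deficit i))
  f = λ i → lookup ε i * -1ℤ ^ toℕ i
  A = sumℕ a
  T = sumℤ f
  Σ = ∑[ i < m ] (lookup ε i * + (n C toℕ i))
  s = -1ℤ ^ m
  c = + (n C m)

  p≡2m+1 : + p ≡ 1ℤ + + m * + 2
  p≡2m+1 = cong (λ z → 1ℤ + z) (trans (cong +_ (2∤1+n⇒n≡n/2*2 n 2∤p)) (ℤ.pos-* m 2))

  Σ*2≡-s*c : Σ * + 2 ≡ -1ℤ * s * c
  -- Equality of the fractions is cross-multiplication by the denominators 2 and 1; swapping `m + 1`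
  -- to `1 + m` lets the power unfold to `-1ℤ * s`.
  Σ*2≡-s*c = trans Σ*2≡ (trans (ℤ.*-identityʳ _)
    (cong (λ k → -1ℤ ^ k * c) (ℕ.+-comm m 1)))

  m≤n : m ≤ n
  m≤n = m/n≤m n 2

  p∣A : p ∣ A
  p∣A = odd-prime∣2*m⇒∣m pr (s≤s 2≤n) (subst (+ p ∣ℤ_)
    (double-deficit (+ p) (+ m) Σ T (+ A) s c p≡2m+1 (sum-deficit 1ℤ f a a-eq) Σ*2≡-s*c
      ([-1]^k*[-1]^k≡1 m))
    -- The three multiples of `p` are `p` itself, `2 * (Σ - T)` and `s * (c - s)`; the last handles
    -- the central coefficient.
    (∣m∣n⇒∣m+n
      (∣m∣n⇒∣m+n ∣-refl
        (∣n⇒∣m*n (+ 2) (binomial-sum≡alternating-sum pr (ℕ.m≤n⇒m≤1+n m≤n) (lookup ε))))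
      (∣n⇒∣m*n s ([p-1]Ck≡[-1]^k m pr m≤n))))

  A<p : A < p
  A<p = s≤s (subst (A ≤_) (sym (2∤1+n⇒n≡n/2*2 n 2∤p)) (sum≤k*b a a≤2))

  A≡0 : A ≡ 0
  A≡0 = n∣m∧m<n⇒m≡0 p∣A A<p

mainTheorem4 : (n : ℕ) → 2 ≤ n → Prime (suc n) → 2 ∤ suc n →
    ((δ : Fin (suc n) → ℤ) →
    (∀ j → δ j ≡ -1ℤ ⊎ δ j ≡ 1ℤ) →
    ∑[ j ≤ n ] (δ j * + (n C toℕ j)) ≡ 0ℤ →
    (∀ j → δ j ≡ -1ℤ ^ toℕ j) ⊎ (∀ j → δ j ≡ - (-1ℤ ^ toℕ j)))
    × Ĵ n ≡ 0
mainTheorem4 n 2≤n pr 2∤p =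
  signs-alternate n 2≤n pr ,
  -- An enumerated vector satisfying `HalfSum` is alternating, which `Counted` excludes, so the
  -- filter keeps nothing.
  cong length (filter-none (counted? n) (All.map
    (λ {ε} ε∈ (half , ¬alt) → ¬alt (halfSum⇒alternating n 2≤n pr 2∤p ε ε∈ half))
    (∈-vectors⇒lookup∈ (-1ℤ ∷ 0ℤ ∷ 1ℤ ∷ []) (n / 2))))
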